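{- Let $G=(V,E)$ be a connected graph. The following statements are equivalent: (i) $G$ is a partial cube. (ii) $G$ is bipartite and all semicubes of $G$ are convex. (iii) $G$ is bipartite and $\theta$ is an equivalence relation on $E$. (iv) $G$ is bipartite and, for all $xy,uv\in E$, $xy\,\theta\,uv$ implies $\{W_{xy},W_{yx}\}=\{W_{uv},W_{vu}\}$. (v) $G$ is bipartite and, for any pair of adjacent vertices of $G$, there is a unique pair of opposite semicubes separating these two vertices.
   Context: Graphs are simple, undirected, nonempty, and not necessarily finite; $d$ denotes the shortest-path distance in $G$. For a set $X$, the hypercube $\mathcal H(X)$ is the graph whose vertices are the finite subsets of $X$, with $P,Q$ adjacent iff $|P\Delta Q|=1$. A graph is a partial cube if it can be isometrically embedded (i.e. by a map preserving shortest-path distances) into $\mathcal H(X)$ for some set $X$. For adjacent $a,b\in V$ the semicube $W_{ab}$ is $W_{ab}=\{w\in V: d(w,a)<d(w,b)\}$; $W_{ab}$ and $W_{ba}$ are opposite semicubes, and a pair of opposite semicubes is the unordered pair of sets $\{W_{ab},W_{ba}\}$. Such a pair separates two vertices if one of the vertices lies in $W_{ab}$ and the other in $W_{ba}$. A set of vertices $W$ is convex if every shortest path in $G$ between two vertices of $W$ lies in $W$. Djokovi\'c's relation $\theta$ on $E$: $xy\,\theta\, f$ iff the edge $f$ joins a vertex in $W_{xy}$ with a vertex in $W_{yx}$. -}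

module Defs where

open import Level using (Level; _⊔_; suc)
open import Data.Bool.Base using (Bool)
open import Data.Empty.Polymorphic using (⊥)
open import Data.List.Base using (List; []; _∷_; [_]; length)
import Data.List.Membership.Setoid as Membership
import Data.List.Relation.Unary.Unique.Setoid as Uniqueness
open import Data.List.Relation.Unary.All using (All)
open import Data.List.Relation.Unary.AllPairs.Core using ([])
open import Data.List.Relation.Unary.Any using (here)
open import Data.Nat.Base as ℕ using (ℕ; _≤_; _<_)
open import Data.Product.Base using (Σ; ∃; ∃-syntax; ∃₂; _×_; _,_)
open import Data.Product using (∃!)
open import Data.Sum.Base as Sum using (_⊎_; inj₁; inj₂; [_,_]′)
open import Function.Bundles using (_⇔_; mk⇔; Equivalence)
open import Function.Definitions using (Congruent)
open import Relation.Binary.Bundles using (Setoid)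
open import Relation.Binary.Core using (Rel)
open import Relation.Binary.Definitions using (Symmetric; _Respects₂_)
open import Relation.Binary.PropositionalEquality.Core using (_≡_; _≢_; refl)
open import Relation.Nullary.Negation.Core using (¬_)
open import Relation.Unary using (Pred; _∈_; _≐_; _∪_; _∖_)
open import Relation.Unary.Properties using (≐-refl; ≐-sym; ≐-trans)

-- The vertices form a setoid because the vertices of a hypercube are
-- finite subsets, which are compared extensionally.

record Graph (c ℓ₁ ℓ₂ : Level) : Set (suc (c ⊔ ℓ₁ ⊔ ℓ₂)) where
  infix 4 _~_
  field
    vertices : Setoid c ℓ₁
  open Setoid vertices public
    using (_≈_)
    renaming (Carrier to V; refl to ≈-refl; sym to ≈-sym; trans to ≈-trans)
  field
    _~_      : Rel V ℓ₂
    ~-resp-≈ : _~_ Respects₂ _≈_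
    ~-sym    : Symmetric _~_
    ~-irrefl : ∀ {v} → ¬ (v ~ v)
    nonempty : V

module _ {c ℓ₁ ℓ₂ : Level} (G : Graph c ℓ₁ ℓ₂) where
  open Graph G

  data Walk : V → V → ℕ → Set (c ⊔ ℓ₁ ⊔ ℓ₂) where
    nil  : ∀ {u v} → u ≈ v → Walk u v 0
    cons : ∀ {u v w n} → u ~ v → Walk v w n → Walk u w (ℕ.suc n)

  visited : ∀ {u v n} → Walk u v n → List V
  visited {u} (nil _)    = [ u ]
  visited {u} (cons _ p) = u ∷ visited p

  -- A walk of minimal length repeats no vertex, so these are exactly the
  -- shortest paths.

  IsShortest : ∀ {u v n} → Walk u v n → Set (c ⊔ ℓ₁ ⊔ ℓ₂)
  IsShortest {u} {v} {n} _ = ∀ {m} → Walk u v m → n ≤ m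

  -- `Distance u v n` says d(u,v) = n; it holds for at most one n, and for
  -- none when u and v lie in different components.

  Distance : V → V → ℕ → Set (c ⊔ ℓ₁ ⊔ ℓ₂)
  Distance u v n = Σ (Walk u v n) IsShortest

  Connected : Set (c ⊔ ℓ₁ ⊔ ℓ₂)
  Connected = ∀ u v → ∃ (Walk u v)

  Bipartite : Set (c ⊔ ℓ₁ ⊔ ℓ₂)
  Bipartite = ∃[ colour ] Congruent _≈_ (_≡_ {A = Bool}) colour
                        × (∀ {u v} → u ~ v → colour u ≢ colour v)

  Convex : ∀ {ℓ} → Pred V ℓ → Set (c ⊔ ℓ₁ ⊔ ℓ₂ ⊔ ℓ)
  Convex W = ∀ {u v n} → u ∈ W → v ∈ W →
             (p : Walk u v n) → IsShortest p → All W (visited p)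

  -- Edges carry an orientation; every notion on edges below is invariant
  -- under reversing it, except `semicube` and `opposite`, which it swaps.

  record Edge : Set (c ⊔ ℓ₂) where
    constructor edge
    field
      {source target} : V
      adjacent        : source ~ target
  open Edge

  W⟨_,_⟩ : V → V → Pred V (c ⊔ ℓ₁ ⊔ ℓ₂)
  W⟨ a , b ⟩ w = ∃₂ λ m n → Distance w a m × Distance w b n × m < n

  semicube opposite : Edge → Pred V (c ⊔ ℓ₁ ⊔ ℓ₂)
  semicube e = W⟨ source e , target e ⟩
  opposite e = W⟨ target e , source e ⟩

  -- An edge represents its pair of opposite semicubes; `SamePair` is
  -- equality of the unordered pairs {W_ab , W_ba}.

  SamePair : Rel Edge (c ⊔ ℓ₁ ⊔ ℓ₂)
  SamePair e f = (semicube e ≐ semicube f × opposite e ≐ opposite f)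
               ⊎ (semicube e ≐ opposite f × opposite e ≐ semicube f)

  Separates : Edge → V → V → Set (c ⊔ ℓ₁ ⊔ ℓ₂)
  Separates e x y = (x ∈ semicube e × y ∈ opposite e)
                  ⊎ (x ∈ opposite e × y ∈ semicube e)

  θ : Rel Edge (c ⊔ ℓ₁ ⊔ ℓ₂)
  θ e f = Separates e (source f) (target f)

  AllSemicubesConvex : Set (c ⊔ ℓ₁ ⊔ ℓ₂)
  AllSemicubesConvex = ∀ {a b} → a ~ b → Convex W⟨ a , b ⟩

  UniqueSeparatingPairs : Set (c ⊔ ℓ₁ ⊔ ℓ₂)
  UniqueSeparatingPairs =
    ∀ {x y} → x ~ y → ∃! SamePair (λ e → Separates e x y)

module _ {c ℓ : Level} (X : Setoid c ℓ) where
  open Setoid X using (Carrier)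
  open Membership X using () renaming (_∈_ to _∈ₗ_)
  open Uniqueness X using (Unique)

  HasCardinality : ∀ {p} → Pred Carrier p → ℕ → Set (c ⊔ ℓ ⊔ p)
  HasCardinality P n =
    ∃[ xs ] Unique xs × length xs ≡ n × (∀ x → x ∈ P ⇔ x ∈ₗ xs)

  -- `finite` forces membership to respect the equality of X.

  record FiniteSubset (p : Level) : Set (c ⊔ ℓ ⊔ suc p) where
    field
      member : Pred Carrier p
      finite : ∃ (HasCardinality member)
  open FiniteSubset

  infixl 6 _△_
  _△_ : ∀ {p} → Pred Carrier p → Pred Carrier p → Pred Carrier p
  P △ Q = (P ∖ Q) ∪ (Q ∖ P)

  △-comm : ∀ {p} {P Q : Pred Carrier p} → P △ Q ≐ Q △ P
  △-comm = Sum.swap , Sum.swap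

  △-congˡ : ∀ {p} {P Q R : Pred Carrier p} → Q ≐ R → P △ Q ≐ P △ R
  △-congˡ (Q⊆R , R⊆Q) =
      (λ { (inj₁ (p , ¬q)) → inj₁ (p , λ r → ¬q (R⊆Q r))
         ; (inj₂ (q , ¬p)) → inj₂ (Q⊆R q , ¬p) })
    , (λ { (inj₁ (p , ¬r)) → inj₁ (p , λ q → ¬r (Q⊆R q))
         ; (inj₂ (r , ¬p)) → inj₂ (R⊆Q r , ¬p) })

  △-congʳ : ∀ {p} {P Q R : Pred Carrier p} → Q ≐ R → Q △ P ≐ R △ P
  △-congʳ {P = P} {Q} {R} Q≐R =
    ≐-trans {i = Q △ P} {j = P △ Q} {k = R △ P} (△-comm {P = Q} {P})
      (≐-trans {i = P △ Q} {j = P △ R} {k = R △ P}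
        (△-congˡ {P = P} {Q} {R} Q≐R) (△-comm {P = P} {R}))

  cardinality-cong : ∀ {p n} {P Q : Pred Carrier p} → P ≐ Q →
                     HasCardinality P n → HasCardinality Q n
  cardinality-cong (P⊆Q , Q⊆P) (xs , uniq , len , mem) =
    xs , uniq , len , λ x →
      mk⇔ (λ q → Equivalence.to (mem x) (Q⊆P q))
          (λ i → P⊆Q (Equivalence.from (mem x) i))

  △-irrefl : ∀ {p} {P : Pred Carrier p} → ¬ HasCardinality (P △ P) 1
  △-irrefl (x ∷ [] , _ , refl , mem) =
    [ (λ (p , ¬p) → ¬p p) , (λ (p , ¬p) → ¬p p) ]′
      (Equivalence.from (mem x) (here (Setoid.refl X)))

  hypercube : (p : Level) → Graph (c ⊔ ℓ ⊔ suc p) (c ⊔ p) (c ⊔ ℓ ⊔ p)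
  hypercube p = record
    { vertices = record
      { Carrier       = FiniteSubset p
      ; _≈_           = λ P Q → member P ≐ member Q
      ; isEquivalence = record
        { refl = ≐-refl ; sym = ≐-sym ; trans = ≐-trans }
      }
    ; _~_      = λ P Q → HasCardinality (member P △ member Q) 1
    ; ~-resp-≈ =
        (λ {P} {Q} {R} Q≐R → cardinality-cong
          (△-congˡ {P = member P} {member Q} {member R} Q≐R))
      , (λ {P} {Q} {R} Q≐R → cardinality-cong
          (△-congʳ {P = member P} {member Q} {member R} Q≐R))
    ; ~-sym    = λ {P} {Q} →
        cardinality-cong (△-comm {P = member P} {member Q})
    ; ~-irrefl = λ {P} → △-irrefl {P = member P}
    ; nonempty = record
      { member = λ _ → ⊥
      ; finite = 0 , [] , [] , refl , λ _ → mk⇔ (λ ()) (λ ())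
      }
    }

record IsometricEmbedding
  {c ℓ₁ ℓ₂ c′ ℓ₁′ ℓ₂′ : Level}
  (G : Graph c ℓ₁ ℓ₂) (H : Graph c′ ℓ₁′ ℓ₂′)
  : Set (c ⊔ ℓ₁ ⊔ ℓ₂ ⊔ c′ ⊔ ℓ₁′ ⊔ ℓ₂′) where
  field
    map      : Graph.V G → Graph.V H
    isometry : ∀ u v n → Distance G u v n ⇔ Distance H (map u) (map v) n

-- "For some set X" is read as "for some setoid X", since the sets indexing
-- such embeddings are typically quotients of the edge set.

PartialCube : ∀ {ℓ} → Graph ℓ ℓ ℓ → Set (suc ℓ)
PartialCube {ℓ} G =
  ∃[ X ] IsometricEmbedding G (hypercube {ℓ} {ℓ} X ℓ)

{-# OPTIONS --safe #-}

-- Call G coherent if, whenever an edge uv crosses the pair {W_xy, W_yx} with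
-- u ∈ W_xy and v ∈ W_yx, one has W_xy ⊆ W_uv; by symmetry this is equality of
-- the two pairs.  For bipartite G each of (ii)-(v) is coherence: a vertex
-- w ∈ W_xy ∩ W_vu puts v on a geodesic from w to u, against convexity, and puts
-- an edge crossing {W_xy, W_yx} on the geodesic from w to v, which by
-- transitivity would be θ-related to uv.
--
-- In an isometrically embedded graph, the ends of an edge xy differ in a single
-- coordinate z, and W_xy consists of the vertices that agree with x at z.
-- Conversely, map v to the set of pairs of opposite semicubes separating v from
-- a root.  The images of u and v differ in the pairs separating u from v, and by
-- coherence these are the pairs of the edges of a geodesic, each occurring once.

module Submission where

open import Level using (Level)
open import Axiom.ExcludedMiddle using (ExcludedMiddle)
open import Data.Bool.Base using (true; not)
open import Data.Bool.Properties using (¬-not; not-¬)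
open import Data.Empty using (⊥-elim)
open import Data.List.Base using ([]; _∷_; length)
import Data.List.Membership.Setoid as Membership
import Data.List.Membership.Setoid.Properties as Membershipₚ
open import Data.List.Relation.Unary.All using (All; []; _∷_)
open import Data.List.Relation.Unary.All.Properties using (¬Any⇒All¬; All¬⇒¬Any)
open import Data.List.Relation.Unary.AllPairs.Core using ([]; _∷_)
open import Data.List.Relation.Unary.Any using (here; there)
import Data.List.Relation.Unary.Unique.Setoid as Uniqueness
open import Data.Nat.Base using (ℕ; zero; suc; _≤_; _<_; z≤n; s≤s; s≤s⁻¹)
open import Data.Nat.GeneralisedArithmetic using (fold)
open import Data.Nat.Properties
  using (≤-antisym; ≤-trans; ≤-refl; ≤-reflexive; <-asym; <-irrefl; <-cmp;
         n≤0⇒n≡0; m≤n⇒m≤1+n; module ≤-Reasoning)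
open import Data.Product.Base using (_×_; ∃; ∃-syntax; ∃₂; _,_; proj₁; proj₂; swap)
open import Data.Sum.Base as Sum using (_⊎_; inj₁; inj₂; [_,_]′)
open import Function.Base using (_∘_; id)
open import Function.Bundles using (_⇔_; mk⇔; Equivalence)
open import Relation.Binary.Bundles using (Setoid)
open import Relation.Binary.Definitions using (_Respects_; tri<; tri≈; tri>)
open import Relation.Binary.PropositionalEquality
  using (_≡_; _≢_; refl; sym; trans; cong; subst; subst₂)
open import Relation.Binary.Structures using (IsEquivalence)
open import Relation.Nullary using (¬_; yes; no; contradiction)
open import Relation.Unary using (Pred; _≐_)

open import Defs

open Equivalence using (to; from)

private
  variable
    c ℓ ℓ₁ ℓ₂ : Level

-- Recursion on the known witness: if `P 0` fails, the search goes on with the shifted predicate and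
-- a smaller witness. This is what turns distance into a function.
least : ExcludedMiddle ℓ → (P : ℕ → Set ℓ) → ∃ P →
        ∃[ m ] P m × (∀ {k} → P k → m ≤ k)
least {ℓ} em P (n , p) = search n P p
  where
  search : ∀ n (P : ℕ → Set ℓ) → P n → ∃[ m ] P m × (∀ {k} → P k → m ≤ k)
  search zero    P p = 0 , p , λ _ → z≤n
  search (suc n) P p with em {P 0}
  ... | yes p₀ = 0 , p₀ , λ _ → z≤n
  ... | no ¬p₀ with search n (P ∘ suc) p
  ...   | m , pₘ , min = suc m , pₘ , λ
          { {zero} p₀ → contradiction p₀ ¬p₀ ; {suc k} pₖ → s≤s (min pₖ) }

-- Elementary operations on walks.

module Walks (G : Graph c ℓ₁ ℓ₂) where
  open Graph G

  walk-respˡ : ∀ {u u′ v n} → u ≈ u′ → Walk G u v n → Walk G u′ v n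
  walk-respˡ u≈u′ (nil u≈v)  = nil (≈-trans (≈-sym u≈u′) u≈v)
  walk-respˡ u≈u′ (cons a p) = cons (proj₂ ~-resp-≈ u≈u′ a) p

  snoc : ∀ {u v w n} → Walk G u v n → v ~ w → Walk G u w (suc n)
  snoc (nil u≈v)  a = cons (proj₂ ~-resp-≈ (≈-sym u≈v) a) (nil ≈-refl)
  snoc (cons b p) a = cons b (snoc p a)

  reverse : ∀ {u v n} → Walk G u v n → Walk G v u n
  reverse (nil u≈v)  = nil (≈-sym u≈v)
  reverse (cons a p) = snoc (reverse p) (~-sym a)

  ~⇒≉ : ∀ {u v} → u ~ v → ¬ (u ≈ v)
  ~⇒≉ a u≈v = ~-irrefl (proj₂ ~-resp-≈ u≈v a)

-- Distance in the hypercube as the cardinality of a symmetric difference.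

module Cardinality (em : ExcludedMiddle ℓ) (X : Setoid ℓ ℓ) where
  open Setoid X using (Carrier; _≈_)
    renaming (refl to ≈-refl; sym to ≈-sym; trans to ≈-trans)
  open Membership X using () renaming (_∈_ to _∈ₗ_)
  open Uniqueness X using (Unique)

  private
    H = hypercube X ℓ
    member : FiniteSubset X ℓ → Pred Carrier ℓ
    member = FiniteSubset.member
    finite : ∀ P → ∃ (HasCardinality X (member P))
    finite = FiniteSubset.finite
    _∆_ : Pred Carrier ℓ → Pred Carrier ℓ → Pred Carrier ℓ
    _∆_ = _△_ X
    Card : Pred Carrier ℓ → ℕ → Set ℓ
    Card = HasCardinality X

  card-resp-≈ : ∀ {S n} → Card S n → S Respects _≈_
  card-resp-≈ (xs , _ , _ , mem) x≈y s =
    from (mem _) (Membershipₚ.∈-resp-≈ X x≈y (to (mem _) s))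

  △-resp-≈ : ∀ {P Q} → P Respects _≈_ → Q Respects _≈_ → (P ∆ Q) Respects _≈_
  △-resp-≈ rP rQ e (inj₁ (p , ¬q)) = inj₁ (rP e p , ¬q ∘ rQ (≈-sym e))
  △-resp-≈ rP rQ e (inj₂ (q , ¬p)) = inj₂ (rQ e q , ¬p ∘ rP (≈-sym e))

  member-resp-≈ : ∀ P → member P Respects _≈_
  member-resp-≈ P = card-resp-≈ (proj₂ (finite P))

  ∉△⇒⊆ : ∀ {P Q : Pred Carrier ℓ} {x} → ¬ (P ∆ Q) x → P x → Q x
  ∉△⇒⊆ {Q = Q} {x} ∉ p with em {Q x}
  ... | yes q = q
  ... | no ¬q = contradiction (inj₁ (p , ¬q)) ∉

  △-split : ∀ {P Q R : Pred Carrier ℓ} {x} → (P ∆ R) x → (P ∆ Q) x ⊎ (Q ∆ R) x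
  △-split {Q = Q} {x = x} (inj₁ (p , ¬r)) with em {Q x}
  ... | yes q = inj₂ (inj₁ (q , ¬r))
  ... | no ¬q = inj₁ (inj₁ (p , ¬q))
  △-split {Q = Q} {x = x} (inj₂ (r , ¬p)) with em {Q x}
  ... | yes q = inj₁ (inj₂ (q , ¬p))
  ... | no ¬q = inj₂ (inj₂ (r , ¬q))

  △-not-all : ∀ {P Q R : Pred Carrier ℓ} {x} → (P ∆ Q) x → (Q ∆ R) x → ¬ (P ∆ R) x
  △-not-all (inj₁ (_ , ¬q)) (inj₁ (q , _)) _ = ¬q q
  △-not-all (inj₂ (q , _)) (inj₂ (_ , ¬q)) _ = ¬q q
  △-not-all (inj₁ _) (inj₂ (r , _)) (inj₁ (_ , ¬r)) = ¬r r
  △-not-all (inj₁ (p , _)) (inj₂ _) (inj₂ (_ , ¬p)) = ¬p p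
  △-not-all (inj₂ (_ , ¬p)) (inj₁ _) (inj₁ (p , _)) = ¬p p
  △-not-all (inj₂ _) (inj₁ (_ , ¬r)) (inj₂ (r , _)) = ¬r r

  -- For sets respecting `≈` this says that `S ∆ T` is the class of `x`, with the coordinate named
  -- and without lists, so that cardinalities can be changed one element at a time.
  record DifferAt (S T : Pred Carrier ℓ) (x : Carrier) : Set ℓ where
    field
      at        : (S ∆ T) x
      elsewhere : ∀ {y} → ¬ (y ≈ x) → S y ⇔ T y
  open DifferAt

  differ-sym : ∀ {S T x} → DifferAt S T x → DifferAt T S x
  differ-sym δ = record
    { at        = Sum.swap (at δ)
    ; elsewhere = λ y≉x → mk⇔ (from (elsewhere δ y≉x)) (to (elsewhere δ y≉x))
    }

  -- Symmetric difference is addition modulo 2, so adding `R` on both sides leaves the difference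
  -- unchanged.
  differ-△ʳ : ∀ {P Q x} (R : Pred Carrier ℓ) →
              DifferAt P Q x → DifferAt (P ∆ R) (Q ∆ R) x
  differ-△ʳ {P} {Q} {x} R δ = record
    { at        = at-△ (at δ)
    ; elsewhere = λ y≉x → mk⇔
        (△-mono {P} {Q} (to (elsewhere δ y≉x)) (from (elsewhere δ y≉x)))
        (△-mono {Q} {P} (from (elsewhere δ y≉x)) (to (elsewhere δ y≉x)))
    }
    where
    △-mono : ∀ {P Q : Pred Carrier ℓ} {y} →
             (P y → Q y) → (Q y → P y) → (P ∆ R) y → (Q ∆ R) y
    △-mono f g (inj₁ (p , ¬r)) = inj₁ (f p , ¬r)
    △-mono f g (inj₂ (r , ¬p)) = inj₂ (r , ¬p ∘ g)

    at-△ : (P ∆ Q) x → ((P ∆ R) ∆ (Q ∆ R)) x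
    at-△ (inj₁ (p , ¬q)) with em {R x}
    ... | yes r = inj₂ (inj₂ (r , ¬q) , [ (λ (_ , ¬r) → ¬r r) , (λ (_ , ¬p) → ¬p p) ]′)
    ... | no ¬r = inj₁ (inj₁ (p , ¬r) , [ (λ (q , _) → ¬q q) , (λ (r , _) → ¬r r) ]′)
    at-△ (inj₂ (q , ¬p)) with em {R x}
    ... | yes r = inj₁ (inj₂ (r , ¬p) , [ (λ (_ , ¬r) → ¬r r) , (λ (_ , ¬q) → ¬q q) ]′)
    ... | no ¬r = inj₂ (inj₁ (q , ¬r) , [ (λ (p , _) → ¬p p) , (λ (r , _) → ¬r r) ]′)

  △-singleton : ∀ {P Q} → Card (P ∆ Q) 1 → ∃ (DifferAt P Q)
  △-singleton {P} {Q} (x ∷ [] , _ , refl , mem) = x , record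
    { at        = from (mem x) (here ≈-refl)
    ; elsewhere = λ {y} y≉x → let ∉△ = λ d → [x]-only y≉x (to (mem y) d) in
        mk⇔ (∉△⇒⊆ {P} {Q} ∉△) (∉△⇒⊆ {Q} {P} (∉△ ∘ Sum.swap))
    }
    where
    [x]-only : ∀ {y} → ¬ (y ≈ x) → ¬ (y ∈ₗ x ∷ [])
    [x]-only y≉x (here y≈x) = y≉x y≈x

  △-support : ∀ {P Q x} → DifferAt P Q x → ∀ {y} → (P ∆ Q) y → y ≈ x
  △-support {x = x} δ {y} d with em {y ≈ x}
  ... | yes y≈x = y≈x
  ... | no  y≉x = contradiction d λ
          { (inj₁ (p , ¬q)) → ¬q (to (elsewhere δ y≉x) p)
          ; (inj₂ (q , ¬p)) → ¬p (from (elsewhere δ y≉x) q) }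

  card-empty : ∀ {S} → (∀ {x} → ¬ S x) → Card S 0
  card-empty ∅ = [] , [] , refl , λ x → mk⇔ (λ s → contradiction s ∅) (λ ())

  card-insert : ∀ {S T x n} → T Respects _≈_ → DifferAt S T x → ¬ S x →
                Card S n → Card T (suc n)
  card-insert {S} {T} {x} resp δ x∉S (xs , uniq , refl , mem) =
    x ∷ xs , ¬Any⇒All¬ xs (x∉S ∘ from (mem x)) ∷ uniq , refl , mem′
    where
    T-x : T x
    T-x = [ (λ (s , _) → contradiction s x∉S) , proj₁ ]′ (at δ)
    mem′ : ∀ y → T y ⇔ y ∈ₗ x ∷ xs
    mem′ y with em {y ≈ x}
    ... | yes y≈x = mk⇔ (λ _ → here y≈x) (λ _ → resp (≈-sym y≈x) T-x)
    ... | no  y≉x = mk⇔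
      (there ∘ to (mem y) ∘ from (elsewhere δ y≉x))
      (λ { (here y≈x) → contradiction y≈x y≉x
         ; (there y∈xs) → to (elsewhere δ y≉x) (from (mem y) y∈xs) })

  list-remove : ∀ {x xs} → Unique xs → x ∈ₗ xs →
                ∃[ ys ] Unique ys × length xs ≡ suc (length ys) ×
                        (∀ y → y ∈ₗ ys ⇔ (y ∈ₗ xs × ¬ (y ≈ x)))
  list-remove {x} {z ∷ xs} (z∉xs ∷ uniq) (here x≈z) = xs , uniq , refl , λ y → mk⇔
    (λ y∈xs → there y∈xs , λ y≈x → All¬⇒¬Any z∉xs
      (Membershipₚ.∈-resp-≈ X (≈-trans y≈x x≈z) y∈xs))
    (λ { (here y≈z , y≉x) → contradiction (≈-trans y≈z (≈-sym x≈z)) y≉x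
       ; (there y∈xs , _) → y∈xs })
  list-remove {x} {z ∷ xs} (z∉xs ∷ uniq) (there x∈xs) with list-remove uniq x∈xs
  ... | ys , uniq′ , len , mem =
      z ∷ ys
    , ¬Any⇒All¬ ys (λ z∈ys → All¬⇒¬Any z∉xs (proj₁ (to (mem z) z∈ys))) ∷ uniq′
    , cong suc len
    , λ y → mk⇔
        (λ { (here y≈z) → here y≈z , λ y≈x → All¬⇒¬Any z∉xs
               (Membershipₚ.∈-resp-≈ X (≈-trans (≈-sym y≈x) y≈z) x∈xs)
           ; (there y∈ys) → there (proj₁ (to (mem y) y∈ys)) , proj₂ (to (mem y) y∈ys) })
        (λ { (here y≈z , _) → here y≈z
           ; (there y∈xs , y≉x) → there (from (mem y) (y∈xs , y≉x)) })

  card-delete : ∀ {S T x n} → T Respects _≈_ → DifferAt S T x → S x →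
                Card S n → ∃[ m ] n ≡ suc m × Card T m
  card-delete {S} {T} {x} resp δ x∈S (xs , uniq , refl , mem)
    with list-remove uniq (to (mem x) x∈S)
  ... | ys , uniq′ , len , mem′ = length ys , len , ys , uniq′ , refl , λ y → mk⇔
      (λ t → let y≉x = λ y≈x → x∉T (resp y≈x t) in
             from (mem′ y) (to (mem y) (from (elsewhere δ y≉x) t) , y≉x))
      (λ y∈ys → let y∈xs , y≉x = to (mem′ y) y∈ys in
                to (elsewhere δ y≉x) (from (mem y) y∈xs))
    where
    x∉T : ¬ T x
    x∉T t = [ (λ (_ , ¬t) → ¬t t) , (λ (_ , ¬s) → ¬s x∈S) ]′ (at δ)

  toggle : Pred Carrier ℓ → Carrier → Pred Carrier ℓ
  toggle S x y = (S y × ¬ (y ≈ x)) ⊎ (¬ S y × y ≈ x)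

  toggle-resp-≈ : ∀ {S} x → S Respects _≈_ → toggle S x Respects _≈_
  toggle-resp-≈ x r e (inj₁ (s , y≉x)) = inj₁ (r e s , y≉x ∘ ≈-trans e)
  toggle-resp-≈ x r e (inj₂ (¬s , y≈x)) = inj₂ (¬s ∘ r (≈-sym e) , ≈-trans (≈-sym e) y≈x)

  toggle-differ : ∀ S x → DifferAt S (toggle S x) x
  toggle-differ S x = record { at = at′ ; elsewhere = λ y≉x → mk⇔
      (λ s → inj₁ (s , y≉x)) [ proj₁ , (λ (_ , y≈x) → contradiction y≈x y≉x) ]′ }
    where
    at′ : (S ∆ toggle S x) x
    at′ with em {S x}
    ... | yes s = inj₁ (s , [ (λ (_ , x≉x) → x≉x ≈-refl) , (λ (¬s , _) → ¬s s) ]′)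
    ... | no ¬s = inj₂ (inj₂ (¬s , ≈-refl) , ¬s)

  -- Induction on `m`: toggling a listed element `x` deletes it, and the same smaller set inherits
  -- an enumeration from each of the two given ones.
  card-unique : ∀ {S} m {n} → Card S m → Card S n → m ≡ n
  card-unique zero ([] , _) ([] , _ , refl , _) = refl
  card-unique zero ([] , _ , _ , mem) (x ∷ _ , _ , _ , mem′)
    with () ← to (mem x) (from (mem′ x) (here ≈-refl))
  card-unique {S} (suc m) S-m@(x ∷ _ , _ , _ , mem) S-n =
    helper (card-delete resp δ s S-m) (card-delete resp δ s S-n)
    where
    resp = toggle-resp-≈ x (card-resp-≈ S-m)
    δ    = toggle-differ S x
    s    = from (mem x) (here ≈-refl)
    helper : ∀ {n} → ∃[ m′ ] suc m ≡ suc m′ × Card (toggle S x) m′ →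
             ∃[ n′ ] n ≡ suc n′ × Card (toggle S x) n′ → suc m ≡ n
    helper (_ , refl , T-m) (_ , refl , T-n) = cong suc (card-unique m T-m T-n)

  member-△-resp-≈ : ∀ P Q → (member P ∆ member Q) Respects _≈_
  member-△-resp-≈ P Q = △-resp-≈ {member P} {member Q} (member-resp-≈ P) (member-resp-≈ Q)

  -- At the coordinate `x` the set `R` sides with `P` against `Q`, so passing from `P` to `Q`
  -- inserts `x` into the difference with `R` and changes nothing else.
  △-card-suc : ∀ P Q R {x n} → DifferAt (member P) (member Q) x →
               ¬ (member R ∆ member P) x →
               Card (member R ∆ member P) n → Card (member R ∆ member Q) (suc n)
  △-card-suc P Q R δ ∉ =
    cardinality-cong X (△-comm X {P = member Q} {member R}) ∘
    card-insert (member-△-resp-≈ Q R) (differ-△ʳ (member R) δ) (∉ ∘ Sum.swap) ∘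
    cardinality-cong X (△-comm X {P = member R} {member P})

  △-card-step : ∀ P Q R {x n} → DifferAt (member P) (member Q) x →
                Card (member Q ∆ member R) n →
                ∃[ m ] m ≤ suc n × Card (member P ∆ member R) m
  △-card-step P Q R {x} {n} δ Q△R-n with em {(member Q ∆ member R) x}
  ... | no ∉ = suc n , ≤-refl ,
      card-insert (member-△-resp-≈ P R) (differ-△ʳ (member R) (differ-sym δ)) ∉ Q△R-n
  ... | yes ∈ with card-delete (member-△-resp-≈ P R) (differ-△ʳ (member R) (differ-sym δ)) ∈ Q△R-n
  -- Here `n` is `suc m`: an element is removed, and the bound holds with room to spare.
  ...   | m , refl , P△R-m = m , m≤n⇒m≤1+n (m≤n⇒m≤1+n ≤-refl) , P△R-m

  -- The lower bound on hypercube distance: every edge changes one coordinate, and a coordinate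
  -- changed twice is restored, whence only an inequality.
  walk⇒card : ∀ {P Q n} → Walk H P Q n → ∃[ m ] m ≤ n × Card (member P ∆ member Q) m
  walk⇒card (nil (P⊆Q , Q⊆P)) = 0 , z≤n , card-empty
    [ (λ (p , ¬q) → ¬q (P⊆Q p)) , (λ (q , ¬p) → ¬p (Q⊆P q)) ]′
  walk⇒card {P} {Q} (cons {v = P′} adj walk) with △-singleton adj | walk⇒card walk
  ... | x , δ | m , m≤n , P′△Q-m with △-card-step P P′ Q δ P′△Q-m
  ...   | k , k≤1+m , P△Q-k = k , ≤-trans k≤1+m (s≤s m≤n) , P△Q-k

  toggled : FiniteSubset X ℓ → Carrier → FiniteSubset X ℓ
  toggled P x = record { member = toggle (member P) x ; finite = finite′ }
    where
    resp = toggle-resp-≈ x (member-resp-≈ P)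
    δ    = toggle-differ (member P) x
    finite′ : ∃ (Card (toggle (member P) x))
    finite′ with em {member P x}
    ... | yes x∈P = let m , _ , T-m = card-delete resp δ x∈P (proj₂ (finite P)) in m , T-m
    ... | no  x∉P = _ , card-insert resp δ x∉P (proj₂ (finite P))

  differ⇒adjacent : ∀ P Q {x} → DifferAt (member P) (member Q) x → Card (member P ∆ member Q) 1
  differ⇒adjacent P Q {x} δ = x ∷ [] , [] ∷ [] , refl , λ y → mk⇔
    (here ∘ △-support δ)
    (λ { (here y≈x) → member-△-resp-≈ P Q (≈-sym y≈x) (at δ) ; (there ()) })

  -- The upper bound: toggling the elements of `member P ∆ member Q` one after another leads from
  -- `P` to `Q`.
  card⇒walk : ∀ n {P Q} → Card (member P ∆ member Q) n → Walk H P Q n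
  card⇒walk zero {P} {Q} ([] , _ , _ , mem) = nil
    ( ∉△⇒⊆ {member P} {member Q} ((λ ()) ∘ to (mem _))
    , ∉△⇒⊆ {member Q} {member P} ((λ ()) ∘ to (mem _) ∘ Sum.swap))
  card⇒walk (suc n) {P} {Q} P△Q-n@(x ∷ _ , _ , _ , mem)
    with card-delete (member-△-resp-≈ (toggled P x) Q)
           (differ-△ʳ (member Q) (toggle-differ (member P) x))
           (from (mem x) (here ≈-refl)) P△Q-n
  ... | _ , refl , P′△Q-n =
    cons {v = toggled P x} (differ⇒adjacent P (toggled P x) (toggle-differ (member P) x))
         (card⇒walk n P′△Q-n)

  distance⇔card : ∀ P Q n → Distance H P Q n ⇔ Card (member P ∆ member Q) n
  distance⇔card P Q n = mk⇔
    (λ (walk , shortest) → let m , m≤n , P△Q-m = walk⇒card walk in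
      subst (Card _) (≤-antisym m≤n (shortest (card⇒walk m P△Q-m))) P△Q-m)
    (λ P△Q-n → card⇒walk n P△Q-n , λ {k} walk → let m , m≤k , P△Q-m = walk⇒card {P} {Q} walk in
      ≤-trans (≤-reflexive (card-unique n P△Q-n P△Q-m)) m≤k)

-- Distance, semicubes and bipartiteness of a connected graph.

module Metric (em : ExcludedMiddle ℓ) (G : Graph ℓ ℓ ℓ) (conn : Connected G) where
  open Graph G
  open Walks G

  private
    geodesic : ∀ u v → ∃[ n ] Walk G u v n × (∀ {k} → Walk G u v k → n ≤ k)
    geodesic u v = least em (Walk G u v) (conn u v)

  dist : V → V → ℕ
  dist u v = proj₁ (geodesic u v)

  dist-walk : ∀ u v → Walk G u v (dist u v)
  dist-walk u v = proj₁ (proj₂ (geodesic u v))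

  dist-min : ∀ {u v n} → Walk G u v n → dist u v ≤ n
  dist-min {u} {v} = proj₂ (proj₂ (geodesic u v))

  dist-distance : ∀ u v → Distance G u v (dist u v)
  dist-distance u v = dist-walk u v , dist-min

  distance⇒dist : ∀ {u v n} → Distance G u v n → n ≡ dist u v
  distance⇒dist (p , shortest) = ≤-antisym (shortest (dist-walk _ _)) (dist-min p)

  dist-sym : ∀ u v → dist u v ≡ dist v u
  dist-sym u v = ≤-antisym (dist-min (reverse (dist-walk v u))) (dist-min (reverse (dist-walk u v)))

  dist-congˡ : ∀ {u u′} v → u ≈ u′ → dist u v ≡ dist u′ v
  dist-congˡ v u≈u′ = ≤-antisym (dist-min (walk-respˡ (≈-sym u≈u′) (dist-walk _ v)))
                                (dist-min (walk-respˡ u≈u′ (dist-walk _ v)))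

  dist-stepˡ : ∀ {u v} w → u ~ v → dist u w ≤ suc (dist v w)
  dist-stepˡ {v = v} w a = dist-min (cons a (dist-walk v w))

  dist-adjacent : ∀ {u v} → u ~ v → Distance G u v 1
  dist-adjacent a = cons a (nil ≈-refl) , λ
    { (nil u≈v) → contradiction u≈v (~⇒≉ a) ; (cons _ _) → s≤s z≤n }

  infix 4 _∈⟨_,_⟩
  _∈⟨_,_⟩ : V → V → V → Set
  w ∈⟨ a , b ⟩ = dist w a < dist w b

  ∈W⇒closer : ∀ {a b w} → W⟨_,_⟩ G a b w → w ∈⟨ a , b ⟩
  ∈W⇒closer (_ , _ , dₐ , d_b , m<n) = subst₂ _<_ (distance⇒dist dₐ) (distance⇒dist d_b) m<n

  closer⇒∈W : ∀ {a b w} → w ∈⟨ a , b ⟩ → W⟨_,_⟩ G a b w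
  closer⇒∈W lt = _ , _ , dist-distance _ _ , dist-distance _ _ , lt

  source-closer : ∀ {u v} → u ~ v → u ∈⟨ u , v ⟩
  source-closer {u} {v} a = subst₂ _<_
    (sym (n≤0⇒n≡0 (dist-min (nil ≈-refl)))) (distance⇒dist (dist-adjacent a)) (s≤s z≤n)

  tail-shortest : ∀ {u w v n} {a : u ~ w} {p : Walk G w v n} →
                  IsShortest G (cons a p) → IsShortest G p
  tail-shortest {a = a} shortest q = s≤s⁻¹ (shortest (cons a q))

  shortest-step : ∀ {u w v n} {a : u ~ w} {p : Walk G w v n} →
                  IsShortest G (cons a p) → dist u v ≡ suc (dist w v)
  shortest-step {a = a} {p} shortest = trans (sym (distance⇒dist (cons a p , shortest)))
    (cong suc (distance⇒dist (p , tail-shortest {a = a} {p} shortest)))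

  -- The metric form of bipartiteness: every edge splits the vertex set into its two opposite
  -- semicubes.
  NoTies : Set ℓ
  NoTies = ∀ {u v} w → u ~ v → dist w u ≢ dist w v

  -- Along a walk the colour is negated once per edge, so equal distances from `w` would give `u`
  -- and `v` the same colour.
  bipartite⇒noTies : Bipartite G → NoTies
  bipartite⇒noTies (colour , resp , proper) {u} {v} w a tie = proper a
    (trans (walk-colour (reverse (dist-walk w u)))
      (trans (cong (fold (colour w) not) tie) (sym (walk-colour (reverse (dist-walk w v))))))
    where
    walk-colour : ∀ {u v n} → Walk G u v n → colour u ≡ fold (colour v) not n
    walk-colour (nil u≈v)  = resp u≈v
    walk-colour (cons a p) = trans (¬-not (proper a)) (cong not (walk-colour p))

  noTies⇒bipartite : NoTies → Bipartite G
  noTies⇒bipartite noTies = colour , cong (fold true not) ∘ dist-congˡ nonempty , proper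
    where
    -- The colour is the parity of the distance to the root `nonempty`; in the absence of ties the
    -- distances of adjacent vertices to it differ by exactly one.
    colour = λ v → fold true not (dist v nonempty)
    parity : ∀ {m n} → m ≤ suc n → n < m → fold true not n ≢ fold true not m
    parity m≤1+n n<m eq =
      not-¬ refl (trans eq (cong (fold true not) (≤-antisym m≤1+n n<m)))
    proper : ∀ {u v} → u ~ v → colour u ≢ colour v
    proper {u} {v} a eq with <-cmp (dist u nonempty) (dist v nonempty)
    ... | tri< lt _ _ = parity (dist-stepˡ _ (~-sym a)) lt eq
    ... | tri≈ _ tie _ = noTies nonempty a
            (trans (dist-sym _ u) (trans tie (dist-sym v _)))
    ... | tri> _ _ gt = parity (dist-stepˡ _ a) gt (sym eq)

  side : NoTies → ∀ {a b} w → a ~ b → w ∈⟨ a , b ⟩ ⊎ w ∈⟨ b , a ⟩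
  side noTies {a} {b} w adj with <-cmp (dist w a) (dist w b)
  ... | tri< lt _ _  = inj₁ lt
  ... | tri≈ _ tie _ = contradiction tie (noTies w adj)
  ... | tri> _ _ gt  = inj₂ gt

  -- Coherence, equality of pairs, and the relation `θ`.

  Coherent : Set ℓ
  Coherent = ∀ {x y u v} → x ~ y → u ~ v → u ∈⟨ x , y ⟩ → v ∈⟨ y , x ⟩ →
             ∀ {w} → w ∈⟨ x , y ⟩ → w ∈⟨ u , v ⟩

  -- The strict inequalities at `u` and `v` make up for the one lost in stepping from `u` to `v`.
  -- This exchanges the roles of the two edges, so that coherence also yields the reverse
  -- inclusions.
  parallel-source : ∀ {x y u v} → u ~ v → u ∈⟨ x , y ⟩ → v ∈⟨ y , x ⟩ → x ∈⟨ u , v ⟩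
  parallel-source {x} {y} {u} {v} a u∈ v∈ = begin-strict
    dist x u        ≡⟨ dist-sym x u ⟩
    dist u x        <⟨ u∈ ⟩
    dist u y        ≤⟨ dist-stepˡ y a ⟩
    suc (dist v y)  ≤⟨ v∈ ⟩
    dist v x        ≡⟨ dist-sym v x ⟩
    dist x v        ∎
    where open ≤-Reasoning

  open Edge

  edge-flip : Edge G → Edge G
  edge-flip e = edge (~-sym (adjacent e))

  separates-sym : ∀ {e x y} → Separates G e x y → Separates G e y x
  separates-sym = Sum.swap ∘ Sum.map swap swap

  coherent⇒samePair : Coherent → ∀ e f → θ G e f → SamePair G e f
  coherent⇒samePair coherent e f (inj₁ (s∈ , t∈)) = inj₁ (
      same (adjacent e) (adjacent f) (∈W⇒closer s∈) (∈W⇒closer t∈)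
    , same (~-sym (adjacent e)) (~-sym (adjacent f)) (∈W⇒closer t∈) (∈W⇒closer s∈))
    where
    same : ∀ {x y u v} → x ~ y → u ~ v → u ∈⟨ x , y ⟩ → v ∈⟨ y , x ⟩ →
           W⟨_,_⟩ G x y ≐ W⟨_,_⟩ G u v
    same a b u∈ v∈ =
        closer⇒∈W ∘ coherent a b u∈ v∈ ∘ ∈W⇒closer
      , closer⇒∈W ∘ coherent b a (parallel-source b u∈ v∈)
          (parallel-source (~-sym b) v∈ u∈) ∘ ∈W⇒closer
  coherent⇒samePair coherent e f (inj₂ (s∈ , t∈)) =
    Sum.swap (coherent⇒samePair coherent e (edge-flip f) (inj₁ (t∈ , s∈)))

  θ-refl : ∀ e → θ G e e
  θ-refl e = inj₁ (closer⇒∈W (source-closer (adjacent e)) ,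
                   closer⇒∈W (source-closer (~-sym (adjacent e))))

  separates-resp : ∀ {e f} → SamePair G e f → ∀ {x y} → Separates G e x y → Separates G f x y
  separates-resp (inj₁ ((S⊆ , _) , (O⊆ , _))) =
    Sum.map (λ (x∈ , y∈) → S⊆ x∈ , O⊆ y∈) (λ (x∈ , y∈) → O⊆ x∈ , S⊆ y∈)
  separates-resp (inj₂ ((S⊆ , _) , (O⊆ , _))) =
    Sum.swap ∘ Sum.map (λ (x∈ , y∈) → S⊆ x∈ , O⊆ y∈) (λ (x∈ , y∈) → O⊆ x∈ , S⊆ y∈)

  samePair-refl : ∀ {e} → SamePair G e e
  samePair-refl = inj₁ ((id , id) , (id , id))

  samePair-sym : ∀ {e f} → SamePair G e f → SamePair G f e
  samePair-sym (inj₁ ((a , a′) , (b , b′))) = inj₁ ((a′ , a) , (b′ , b))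
  samePair-sym (inj₂ ((a , a′) , (b , b′))) = inj₂ ((b′ , b) , (a′ , a))

  samePair-trans : ∀ {e f g} → SamePair G e f → SamePair G f g → SamePair G e g
  samePair-trans (inj₁ ((a , a′) , (b , b′))) (inj₁ ((p , p′) , (q , q′))) =
    inj₁ ((p ∘ a , a′ ∘ p′) , (q ∘ b , b′ ∘ q′))
  samePair-trans (inj₁ ((a , a′) , (b , b′))) (inj₂ ((p , p′) , (q , q′))) =
    inj₂ ((p ∘ a , a′ ∘ p′) , (q ∘ b , b′ ∘ q′))
  samePair-trans (inj₂ ((a , a′) , (b , b′))) (inj₁ ((p , p′) , (q , q′))) =
    inj₂ ((q ∘ a , a′ ∘ q′) , (p ∘ b , b′ ∘ p′))
  samePair-trans (inj₂ ((a , a′) , (b , b′))) (inj₂ ((p , p′) , (q , q′))) =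
    inj₁ ((q ∘ a , a′ ∘ q′) , (p ∘ b , b′ ∘ p′))

  -- The second half of (iv). With `samePair⇒θ` it makes `θ` coincide with equality of pairs, from
  -- which (iii) and (v) are read off.
  θ⊆SamePair : Set ℓ
  θ⊆SamePair = ∀ e f → θ G e f → SamePair G e f

  samePair⇒θ : ∀ {e f} → SamePair G e f → θ G e f
  samePair⇒θ {e} {f} e≈f = separates-resp {f} {e} (samePair-sym {e} {f} e≈f) (θ-refl f)

  θ⊆samePair⇒coherent : θ⊆SamePair → Coherent
  θ⊆samePair⇒coherent same {x} a b u∈ v∈ w∈
    with same (edge a) (edge b) (inj₁ (closer⇒∈W u∈ , closer⇒∈W v∈))
  ... | inj₁ ((S⊆ , _) , _) = ∈W⇒closer (S⊆ (closer⇒∈W w∈))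
  -- This alternative would put `x` into `W⟨ v , u ⟩`, while `parallel-source` puts it into
  -- `W⟨ u , v ⟩`.
  ... | inj₂ ((S⊆ , _) , _) =
    contradiction (∈W⇒closer (S⊆ (closer⇒∈W (source-closer a))))
                  (<-asym (parallel-source b u∈ v∈))

  θ⊆samePair⇒equivalence : θ⊆SamePair → IsEquivalence (θ G)
  θ⊆samePair⇒equivalence same = record
    { refl  = λ {e} → θ-refl e
    ; sym   = λ {e} {f} → samePair⇒θ {f} {e} ∘ samePair-sym {e} {f} ∘ same e f
    ; trans = λ {e} {f} {g} p q →
        samePair⇒θ {e} {g} (samePair-trans {e} {f} {g} (same e f p) (same f g q))
    }

  θ⊆samePair⇒unique : θ⊆SamePair → UniqueSeparatingPairs G
  θ⊆samePair⇒unique same a = edge a , θ-refl (edge a) , λ {e} sep →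
    samePair-sym {e} {edge a} (same e (edge a) sep)

  unique⇒θ⊆samePair : UniqueSeparatingPairs G → θ⊆SamePair
  unique⇒θ⊆samePair unique e f θef =
    let g , _ , g-unique = unique (adjacent f) in
    samePair-trans {e} {g} {f} (samePair-sym {g} {e} (g-unique {e} θef))
      (g-unique {f} (θ-refl f))

  -- Convexity and equivalence of `θ` against coherence, in the absence of ties.

  module _ (noTies : NoTies) where

    -- Follow the geodesic from its start. If the edge from `u` to `w` left the semicube, coherence
    -- would put the end `v` closer to `u` than to `w`, although `w` is one step nearer to `v`.
    coherent⇒convex : Coherent → AllSemicubesConvex G
    coherent⇒convex coherent {a} {b} adj {v = v} u∈W v∈W = go u∈W
      where
      go : ∀ {u n} → W⟨_,_⟩ G a b u → (p : Walk G u v n) → IsShortest G p →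
           All (W⟨_,_⟩ G a b) (visited G p)
      go u∈W (nil _) _ = u∈W ∷ []
      go u∈W (cons {v = w} u~w p) shortest with side noTies w adj
      ... | inj₁ w∈ = u∈W ∷ go (closer⇒∈W w∈) p (tail-shortest {a = u~w} {p} shortest)
      ... | inj₂ w∈ = contradiction
        (coherent adj u~w (∈W⇒closer u∈W) w∈ (∈W⇒closer v∈W))
        (<-asym (subst₂ _<_ (dist-sym _ v) (dist-sym _ v)
          (≤-reflexive (sym (shortest-step {a = u~w} {p} shortest)))))

    convex⇒coherent : AllSemicubesConvex G → Coherent
    convex⇒coherent convex {x} {y} {u} {v} a b u∈ v∈ {w} w∈ with side noTies w b
    ... | inj₁ w∈uv = w∈uv
    ... | inj₂ w∈vu = contradiction v∈ (<-asym (∈W⇒closer (v∈W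
          (convex a (closer⇒∈W u∈) (closer⇒∈W w∈) (cons b (dist-walk v w)) shortest))))
      where
      v∈W : ∀ {n} {p : Walk G v w n} → All (W⟨_,_⟩ G x y) (visited G (cons b p)) → W⟨_,_⟩ G x y v
      v∈W {p = nil _} (_ ∷ v∈ ∷ _)    = v∈
      v∈W {p = cons _ _} (_ ∷ v∈ ∷ _) = v∈
      shortest : IsShortest G (cons b (dist-walk v w))
      shortest q = ≤-trans (subst₂ _<_ (dist-sym w v) (dist-sym w u) w∈vu) (dist-min q)

    -- A walk between opposite semicubes crosses over at some edge. Its vertices stay closer to `v`
    -- than to `u`, since each step of a geodesic to `v` lowers the distance to `v` by one and that
    -- to `u` by at most one.
    crossing : ∀ {x y u v w n} → x ~ y → (p : Walk G w v n) → IsShortest G p →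
               w ∈⟨ x , y ⟩ → v ∈⟨ y , x ⟩ → w ∈⟨ v , u ⟩ →
               ∃₂ λ a b → a ~ b × a ∈⟨ x , y ⟩ × b ∈⟨ y , x ⟩ × a ∈⟨ v , u ⟩ × b ∈⟨ v , u ⟩
    crossing {x} {y} adj (nil w≈v) _ w∈ v∈ _ =
      contradiction (subst₂ _<_ (dist-congˡ x w≈v) (dist-congˡ y w≈v) w∈) (<-asym v∈)
    crossing {x} {y} {u} {v} {w} adj (cons {v = z} w~z p) shortest w∈ v∈ w∈vu
      with side noTies z adj
         | s≤s⁻¹ (≤-trans (subst (_< dist w u) (shortest-step {a = w~z} {p} shortest) w∈vu)
                          (dist-stepˡ u w~z))
    ... | inj₁ z∈ | z∈vu = crossing adj p (tail-shortest {a = w~z} {p} shortest) z∈ v∈ z∈vu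
    ... | inj₂ z∈ | z∈vu = w , z , w~z , w∈ , z∈ , w∈vu , z∈vu

    equivalence⇒coherent : IsEquivalence (θ G) → Coherent
    equivalence⇒coherent θ-eq {x} {y} {u} {v} x~y u~v u∈ v∈ {w} w∈ with side noTies w u~v
    ... | inj₁ w∈uv = w∈uv
    ... | inj₂ w∈vu with crossing x~y (dist-walk w v) dist-min w∈ v∈ w∈vu
    -- Both ends of this edge lie in `W⟨ v , u ⟩`, so it cannot cross the pair of `u~v`, as `θfg`
    -- claims.
    ...   | a , b , a~b , a∈ , b∈ , a∈vu , b∈vu = ⊥-elim
      ([ (λ (a∈uv , _) → <-asym a∈vu (∈W⇒closer a∈uv))
       , (λ (_ , b∈uv) → <-asym b∈vu (∈W⇒closer b∈uv)) ]′ θfg)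
      where
      open IsEquivalence θ-eq using () renaming (sym to θ-sym; trans to θ-trans)
      θfg : θ G (edge u~v) (edge a~b)
      θfg = θ-trans {edge u~v} {edge x~y} {edge a~b}
        (θ-sym {edge x~y} {edge u~v} (inj₁ (closer⇒∈W u∈ , closer⇒∈W v∈)))
        (inj₁ (closer⇒∈W a∈ , closer⇒∈W b∈))

    opposite-disjoint : ∀ e {w} → semicube G e w → ¬ opposite G e w
    opposite-disjoint e w∈ w∈′ = <-asym (∈W⇒closer w∈) (∈W⇒closer w∈′)

    -- Separation is inequality of a two-valued function, the side on which a vertex lies. This is
    -- the analogue of `△-split`, and `separates-not-all` that of `△-not-all`.
    separates-cases : ∀ e {u v} → Separates G e u v → ∀ w →
                      Separates G e u w ⊎ Separates G e w v
    separates-cases e sep w with sep | side noTies w (adjacent e)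
    ... | inj₁ (u∈ , v∈) | inj₁ w∈ = inj₂ (inj₁ (closer⇒∈W w∈ , v∈))
    ... | inj₁ (u∈ , v∈) | inj₂ w∈ = inj₁ (inj₁ (u∈ , closer⇒∈W w∈))
    ... | inj₂ (u∈ , v∈) | inj₁ w∈ = inj₁ (inj₂ (u∈ , closer⇒∈W w∈))
    ... | inj₂ (u∈ , v∈) | inj₂ w∈ = inj₂ (inj₂ (closer⇒∈W w∈ , v∈))

    separates-not-all : ∀ e {u v w} → Separates G e u v → Separates G e v w → ¬ Separates G e u w
    separates-not-all e (inj₁ (_ , v∈)) (inj₁ (v∈′ , _)) _ = opposite-disjoint e v∈′ v∈
    separates-not-all e (inj₂ (_ , v∈)) (inj₂ (v∈′ , _)) _ = opposite-disjoint e v∈ v∈′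
    separates-not-all e (inj₁ _) (inj₂ (_ , w∈)) (inj₁ (_ , w∈′)) = opposite-disjoint e w∈ w∈′
    separates-not-all e (inj₁ (u∈ , _)) (inj₂ _) (inj₂ (u∈′ , _)) = opposite-disjoint e u∈ u∈′
    separates-not-all e (inj₂ (u∈ , _)) (inj₁ _) (inj₁ (u∈′ , _)) = opposite-disjoint e u∈′ u∈
    separates-not-all e (inj₂ _) (inj₁ (_ , w∈)) (inj₂ (_ , w∈′)) = opposite-disjoint e w∈′ w∈

    -- The embedding by pairs of opposite semicubes.

    module _ (same : θ⊆SamePair) where

      Cuts : Setoid ℓ ℓ
      Cuts = record
        { Carrier       = Edge G
        ; _≈_           = SamePair G
        ; isEquivalence = record
          { refl  = λ {e} → samePair-refl {e}
          ; sym   = λ {e} {f} → samePair-sym {e} {f}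
          ; trans = λ {e} {f} {g} → samePair-trans {e} {f} {g}
          }
        }

      Separating : V → V → Pred (Edge G) ℓ
      Separating u v e = Separates G e u v

      open Cardinality em Cuts

      not-separating-tail : ∀ {u w v} (a : u ~ w) → v ∈⟨ w , u ⟩ → ¬ Separating w v (edge a)
      not-separating-tail a v∈ (inj₁ (w∈ , _)) = <-asym (∈W⇒closer w∈) (source-closer (~-sym a))
      not-separating-tail a v∈ (inj₂ (_ , v∈′)) = <-asym (∈W⇒closer v∈′) v∈

      -- A pair that separates the adjacent vertices `u` and `w` is `θ`-related to `a`, hence equal
      -- to its pair by `same`; every other pair has `u` and `w` on one side.
      separating-adjacent : ∀ {u w v} (a : u ~ w) → v ∈⟨ w , u ⟩ →
                            DifferAt (Separating w v) (Separating u v) (edge a)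
      separating-adjacent {u} {w} {v} a v∈ = record
        { at = inj₂ (inj₁ (closer⇒∈W (source-closer a) , closer⇒∈W v∈) , not-separating-tail a v∈)
        ; elsewhere = λ {e} e≉a → mk⇔
            (λ wv → [ (λ wu → contradiction (same e (edge a) (separates-sym {e} wu)) e≉a) , id ]′
              (separates-cases e wv u))
            (λ uv → [ (λ uw → contradiction (same e (edge a) uw) e≉a) , id ]′
              (separates-cases e uv w))
        }

      -- Induction from the far end of the geodesic. Prefixing the edge `a` adds its pair, which is
      -- new because `w` and `v` lie on the same side of it.
      card-separating : ∀ {u v n} (p : Walk G u v n) → IsShortest G p →
                        HasCardinality Cuts (Separating u v) n
      card-separating {u} {v} (nil u≈v) _ = card-empty λ {e} →
        [ (λ (u∈ , v∈) → <-asym (∈W⇒closer v∈) (transport (∈W⇒closer u∈)))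
        , (λ (u∈ , v∈) → <-asym (∈W⇒closer v∈) (transport (∈W⇒closer u∈))) ]′
        where
        transport : ∀ {a b} → u ∈⟨ a , b ⟩ → v ∈⟨ a , b ⟩
        transport = subst₂ _<_ (dist-congˡ _ u≈v) (dist-congˡ _ u≈v)
      card-separating {u} {v} (cons {v = w} a p) shortest = card-insert
        (λ {e} {f} e≈f → separates-resp {e} {f} e≈f)
        (separating-adjacent a v∈) (not-separating-tail a v∈)
        (card-separating p (tail-shortest {a = a} {p} shortest))
        where
        v∈ : v ∈⟨ w , u ⟩
        v∈ = subst₂ _<_ (dist-sym w v) (dist-sym u v)
          (≤-reflexive (sym (shortest-step {a = a} {p} shortest)))

      cuts-from-root : V → FiniteSubset Cuts ℓ
      cuts-from-root v = record
        { member = Separating v nonempty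
        ; finite = _ , card-separating (dist-walk v nonempty) dist-min
        }

      -- Separation adds modulo 2 along `u`, `nonempty`, `v`, so the root drops out of the
      -- difference.
      △-separating : ∀ u v →
        _△_ Cuts (Separating u nonempty) (Separating v nonempty) ≐ Separating u v
      △-separating u v =
          (λ { {e} (inj₁ (ur , ¬vr)) →
                 [ id , (λ vr → contradiction vr ¬vr) ]′ (separates-cases e ur v)
             ; {e} (inj₂ (vr , ¬ur)) →
                 [ separates-sym {e} , (λ ur → contradiction ur ¬ur) ]′ (separates-cases e vr u) })
        , (λ {e} uv → Sum.map
             (λ ur → ur , λ vr → separates-not-all e uv vr ur)
             (λ rv → let vr = separates-sym {e} rv in vr , separates-not-all e uv vr)
             (separates-cases e uv nonempty))

      partialCube : PartialCube G
      partialCube = Cuts , record { map = cuts-from-root ; isometry = isometry }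
        where
        card-△ : ∀ u v → HasCardinality Cuts
          (_△_ Cuts (Separating u nonempty) (Separating v nonempty)) (dist u v)
        card-△ u v = cardinality-cong Cuts (swap (△-separating u v))
          (card-separating (dist-walk u v) dist-min)
        isometry : ∀ u v n → Distance G u v n ⇔
          Distance (hypercube Cuts ℓ) (cuts-from-root u) (cuts-from-root v) n
        isometry u v n = mk⇔
          (λ d → from distance⇔ (subst (HasCardinality Cuts _) (sym (distance⇒dist d)) (card-△ u v)))
          (λ d → subst (Distance G u v) (card-unique _ (card-△ u v) (to distance⇔ d))
                   (dist-distance u v))
          where
          distance⇔ = distance⇔card (cuts-from-root u) (cuts-from-root v) n

  -- Isometrically embedded graphs are bipartite and coherent.

  module _ {X : Setoid ℓ ℓ} (embedding : IsometricEmbedding G (hypercube X ℓ)) where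
    open IsometricEmbedding embedding
    open Cardinality em X

    private
      f : V → Pred (Setoid.Carrier X) ℓ
      f v = FiniteSubset.member (map v)

    card-dist : ∀ u v → HasCardinality X (_△_ X (f u) (f v)) (dist u v)
    card-dist u v = to (distance⇔card (map u) (map v) _) (to (isometry u v _) (dist-distance u v))

    coordinate : ∀ {u v} → u ~ v → ∃ (DifferAt (f u) (f v))
    coordinate a = △-singleton
      (to (distance⇔card (map _) (map _) 1) (to (isometry _ _ 1) (dist-adjacent a)))

    -- The set of `w` differs from that of `v` wherever it differs from that of `u`, and at `z` in
    -- addition, so `dist w v` is exactly `suc (dist w u)`.
    agree⇒closer : ∀ {u v w z} → DifferAt (f u) (f v) z →
                   ¬ _△_ X (f w) (f u) z → w ∈⟨ u , v ⟩
    agree⇒closer {u} {v} {w} δ ∉ = ≤-reflexive (card-unique _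
      (△-card-suc (map u) (map v) (map w) δ ∉ (card-dist w u)) (card-dist w v))

    disagree⇒closer : ∀ {u v w z} → DifferAt (f u) (f v) z →
                      _△_ X (f w) (f u) z → w ∈⟨ v , u ⟩
    disagree⇒closer {u} {v} {w} δ ∈ = agree⇒closer (differ-sym δ)
      (△-not-all {f w} {f u} {f v} ∈ (DifferAt.at δ))

    closer⇒agree : ∀ {u v w z} → DifferAt (f u) (f v) z →
                   w ∈⟨ u , v ⟩ → ¬ _△_ X (f w) (f u) z
    closer⇒agree {u} {v} {w} δ w∈ ∈ = <-asym w∈ (disagree⇒closer {u} {v} {w} δ ∈)

    -- At the coordinate of an edge every vertex agrees with exactly one of the two ends.
    embedded⇒noTies : NoTies
    embedded⇒noTies {u} {v} w a tie with coordinate a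
    ... | z , δ with em {_△_ X (f w) (f u) z}
    ...   | yes ∈ = <-irrefl (sym tie) (disagree⇒closer {u} {v} {w} δ ∈)
    ...   | no  ∉ = <-irrefl tie (agree⇒closer {u} {v} {w} δ ∉)

    -- As `u` agrees with `x` at `z` and `v` with `y`, the sets of `u` and `v` differ at `z`, which
    -- is therefore the coordinate `z′` of their edge. A vertex agreeing with `x` there agrees with
    -- `u`.
    embedded⇒coherent : Coherent
    embedded⇒coherent {x} {y} {u} {v} a b u∈ v∈ {w} w∈ with coordinate a | coordinate b
    ... | z , δ | z′ , δ′ = agree⇒closer {u} {v} {w} δ′ λ d →
        let d′ = △-resp-≈ {f w} {f u} (member-resp-≈ (map w)) (member-resp-≈ (map u))
                   (Setoid.sym X z≈z′) d
        in [ closer⇒agree {x} {y} {w} δ w∈ , u-agrees ∘ Sum.swap ]′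
             (△-split {f w} {f x} {f u} d′)
      where
      u-agrees : ¬ _△_ X (f u) (f x) z
      u-agrees = closer⇒agree {x} {y} {u} δ u∈

      v-agrees : ¬ _△_ X (f v) (f y) z
      v-agrees = closer⇒agree {y} {x} {v} (differ-sym δ) v∈

      z-separates : _△_ X (f u) (f v) z
      z-separates with △-split {f x} {f u} {f y} (DifferAt.at δ)
      ... | inj₁ xu = contradiction (Sum.swap xu) u-agrees
      ... | inj₂ uy with △-split {f u} {f v} {f y} uy
      ...   | inj₁ uv = uv
      ...   | inj₂ vy = contradiction vy v-agrees

      z≈z′ : Setoid._≈_ X z z′
      z≈z′ = △-support δ′ z-separates

theorem3p4 : {ℓ : Level} → ExcludedMiddle ℓ →
    (G : Graph ℓ ℓ ℓ) → Connected G →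
    (PartialCube G ⇔ (Bipartite G × AllSemicubesConvex G))
    × (PartialCube G ⇔ (Bipartite G × IsEquivalence (θ G)))
    × (PartialCube G ⇔ (Bipartite G × (∀ e f → θ G e f → SamePair G e f)))
    × (PartialCube G ⇔ (Bipartite G × UniqueSeparatingPairs G))
theorem3p4 em G conn =
    via (λ noTies → coherent⇒convex noTies) convex⇒coherent
  , via (λ _ → θ⊆samePair⇒equivalence ∘ coherent⇒samePair) equivalence⇒coherent
  , via (λ _ → coherent⇒samePair) (λ _ → θ⊆samePair⇒coherent)
  , via (λ _ → θ⊆samePair⇒unique ∘ coherent⇒samePair)
        (λ _ → θ⊆samePair⇒coherent ∘ unique⇒θ⊆samePair)
  where
  open Metric em G conn

  -- Every equivalence passes through `NoTies` and `Coherent`: an embedding provides both, and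
  -- together they build the embedding into the hypercube on `Cuts`.
  via : ∀ {a} {A : Set a} → (NoTies → Coherent → A) → (NoTies → A → Coherent) →
        PartialCube G ⇔ (Bipartite G × A)
  via fwd bwd = mk⇔
    (λ (_ , embedding) → let noTies = embedded⇒noTies embedding in
      noTies⇒bipartite noTies , fwd noTies (embedded⇒coherent embedding))
    (λ (bipartite , a) → let noTies = bipartite⇒noTies bipartite in
      partialCube noTies (coherent⇒samePair (bwd noTies a)))
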